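{- Let $d$ and $\Delta$ be integers with $1\le d\le\Delta$, and let $G$ be a finite simple $d$-degenerate graph with maximum degree $\Delta(G)\le\Delta$. Then $$q_B(G)\le \Delta+(d-1)\Delta_2(G)\le d\Delta.$$
   Context: A $B$-coloring of a graph $G$ is a proper edge-coloring (incident edges receive distinct colors) in which the edges of every $4$-cycle receive four distinct colors; $q_B(G)$ is the minimum number of colors in a $B$-coloring of $G$. The maximum codegree is $\Delta_2(G)=\max_{x\ne y}|N_G(x)\cap N_G(y)|$ over pairs of distinct vertices $x,y$ of $G$, with $\Delta_2(G)=0$ when $|V(G)|<2$; here $N_G(x)$ is the open neighborhood of $x$. A graph is $d$-degenerate if every nonempty subgraph has a vertex of degree at most $d$ (in that subgraph). $\Delta(G)$ denotes the maximum degree of $G$. -}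

module Defs where

open import Data.Empty using (⊥-elim)
open import Data.Fin.Base using (Fin; zero; toℕ; fromℕ<; inject₁; combine; remQuot; finToFun; funToFin)
open import Data.Fin.Properties using (toℕ<n; toℕ-fromℕ<; toℕ-inject₁; toℕ-injective; all?; any?; combine-injective; remQuot-combine; finToFun-funToFin) renaming (_≟_ to _≟ᶠ_; ≤-total to ≤ᶠ-total; ≤-antisym to ≤ᶠ-antisym; _≤?_ to _≤ᶠ?_)
open import Data.Fin.Subset using (Subset; _∈_; _∩_; ∣_∣; Nonempty)
open import Data.List.Base using (List; []; _∷_; map; filter; allFin; cartesianProduct)
open import Data.List.Extrema.Nat using (max)
open import Data.List.Relation.Unary.All using ([]; _∷_)
open import Data.List.Relation.Unary.AllPairs using ([]; _∷_)
open import Data.List.Relation.Unary.Unique.Propositional using (Unique)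
import Data.List.Relation.Unary.Unique.Propositional.Properties as Unique
import Data.List.Relation.Unary.Unique.DecPropositional as DecUnique
open import Data.Nat.Base using (ℕ; zero; suc; _*_; _^_; _≤_; _<_)
open import Data.Nat.Properties using (_≟_; _<?_; n<1+n; m<1+n⇒m<n∨m≡n; ≮⇒≥)
open import Data.Product.Base using (Σ-syntax; ∃-syntax; _×_; _,_; proj₁; proj₂; uncurry)
open import Data.Sum.Base using (_⊎_; inj₁; inj₂)
open import Data.Vec.Base using (tabulate)
open import Level using (0ℓ)
open import Relation.Binary.Core using (Rel; _⇒_)
open import Relation.Binary.Definitions using (Decidable; Symmetric; Irreflexive)
open import Relation.Binary.PropositionalEquality using (_≡_; _≢_; refl; sym; trans; cong; cong₂; subst)
open import Relation.Nullary using (Dec; yes; no; does; ¬_; ¬?; recompute)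
open import Relation.Nullary.Decidable using (map′; _×-dec_; _→-dec_)
import Relation.Unary as U

private
  variable
    n k : ℕ

record Graph (n : ℕ) : Set₁ where
  infix 4 _~_ _~?_
  field
    _~_      : Rel (Fin n) 0ℓ
    _~?_     : Decidable _~_
    ~-sym    : Symmetric _~_
    ~-irrefl : Irreflexive _≡_ _~_

  neighbourhood : Fin n → Subset n
  neighbourhood x = tabulate (λ y → does (x ~? y))

  degree : Fin n → ℕ
  degree x = ∣ neighbourhood x ∣

  maxDegree : ℕ
  maxDegree = max 0 (map degree (allFin n))

  codegree : Fin n → Fin n → ℕ
  codegree x y = ∣ neighbourhood x ∩ neighbourhood y ∣

  maxCodegree : ℕ
  maxCodegree = max 0 (map (uncurry codegree) distinctPairs)
    where
    distinctPairs : List (Fin n × Fin n)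
    distinctPairs = filter (λ (x , y) → ¬? (x ≟ᶠ y)) (cartesianProduct (allFin n) (allFin n))

  record FourCycle (w x y z : Fin n) : Set where
    field
      distinct : Unique (w ∷ x ∷ y ∷ z ∷ [])
      wx       : w ~ x
      xy       : x ~ y
      yz       : y ~ z
      zw       : z ~ w

-- A not necessarily induced subgraph.  Its edges are kept as a graph on the
-- ambient vertex set, isolated outside `vertices`, so that the degree of a
-- vertex in the subgraph is its `degree` in `edges`.
record Subgraph (G : Graph n) : Set₁ where
  field
    vertices   : Subset n
    edges      : Graph n
    edges⊆G    : Graph._~_ edges ⇒ Graph._~_ G
    endpoints∈ : ∀ {x y} → Graph._~_ edges x y → x ∈ vertices × y ∈ vertices

Degenerate : ℕ → Graph n → Set₁
Degenerate d G = (H : Subgraph G) → Nonempty (Subgraph.vertices H) →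
  ∃[ v ] v ∈ Subgraph.vertices H × Graph.degree (Subgraph.edges H) v ≤ d

-- The adjacency proof passed to `colour` is irrelevant, so with `colour-sym`
-- a colour depends only on the unordered pair of endpoints, and only edges
-- are coloured (in particular 0 colours suffice for an edgeless graph).
record BColouring (G : Graph n) (k : ℕ) : Set where
  open Graph G
  field
    colour     : ∀ u v → .(u ~ v) → Fin k
    colour-sym : ∀ {u v} (e : u ~ v) → colour u v e ≡ colour v u (~-sym e)
    proper     : ∀ {u v w} (e : u ~ v) (f : u ~ w) → v ≢ w → colour u v e ≢ colour u w f
    rainbow-C₄ : ∀ {w x y z} (C : FourCycle w x y z) → let open FourCycle C in
                 Unique (colour w x wx ∷ colour x y xy ∷ colour y z yz ∷ colour z w zw ∷ [])

IsLeast : (ℕ → Set) → ℕ → Set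
IsLeast P m = P m × (∀ {k} → P k → m ≤ k)

private
  least-below : {P : ℕ → Set} → U.Decidable P → ∀ m →
                (Σ[ j ∈ ℕ ] IsLeast P j) ⊎ (∀ {j} → j < m → ¬ P j)
  least-below P? zero = inj₂ λ ()
  least-below {P} P? (suc m) with least-below P? m
  ... | inj₁ l = inj₁ l
  ... | inj₂ none with P? m
  ...   | yes p = inj₁ (m , p , λ q → ≮⇒≥ (λ j<m → none j<m q))
  ...   | no ¬p = inj₂ step
    where
    step : ∀ {j} → j < suc m → ¬ P j
    step j<1+m with m<1+n⇒m<n∨m≡n j<1+m
    ... | inj₁ j<m  = none j<m
    ... | inj₂ refl = ¬p

  least : {P : ℕ → Set} → U.Decidable P → ∀ {m} → P m → Σ[ j ∈ ℕ ] IsLeast P j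
  least P? {m} p with least-below P? (suc m)
  ... | inj₁ l    = l
  ... | inj₂ none = ⊥-elim (none (n<1+n m) p)

-- B-colourings are searched for among the finitely many tables of colours
-- indexed by ordered pairs of vertices; entries at non-edges are ignored.
private
  module Existence {n} (G : Graph n) where
    open Graph G

    Table : Set
    Table = Fin n → Fin n → ℕ

    record Valid (k : ℕ) (t : Table) : Set where
      constructor valid
      field
        bounded : ∀ u v → u ~ v → t u v < k
        symm    : ∀ u v → u ~ v → t u v ≡ t v u
        prop    : ∀ u v w → u ~ v → u ~ w → v ≢ w → t u v ≢ t u w
        rainbow : ∀ w x y z → FourCycle w x y z →
                  Unique (t w x ∷ t x y ∷ t y z ∷ t z w ∷ [])

    fourCycle? : ∀ w x y z → Dec (FourCycle w x y z)
    fourCycle? w x y z =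
      map′ (λ (d , a , b , c , e) → record { distinct = d ; wx = a ; xy = b ; yz = c ; zw = e })
           (λ C → let open FourCycle C in distinct , wx , xy , yz , zw)
           (DecUnique.unique? _≟ᶠ_ (w ∷ x ∷ y ∷ z ∷ [])
             ×-dec (w ~? x) ×-dec (x ~? y) ×-dec (y ~? z) ×-dec (z ~? w))

    valid? : ∀ k t → Dec (Valid k t)
    valid? k t =
      map′ (λ (b , s , p , r) → valid b s p r)
           (λ (valid b s p r) → b , s , p , r)
           ((all? λ u → all? λ v → (u ~? v) →-dec (t u v <? k))
            ×-dec (all? λ u → all? λ v → (u ~? v) →-dec (t u v ≟ t v u))
            ×-dec (all? λ u → all? λ v → all? λ w →
                     (u ~? v) →-dec ((u ~? w) →-dec
                       (¬? (v ≟ᶠ w) →-dec ¬? (t u v ≟ t u w))))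
            ×-dec (all? λ w → all? λ x → all? λ y → all? λ z →
                     fourCycle? w x y z →-dec
                       DecUnique.unique? _≟_ (t w x ∷ t x y ∷ t y z ∷ t z w ∷ [])))

    fromTable : ∀ {t} → Valid k t → BColouring G k
    fromTable {k} {t} V = record
      { colour     = col
      ; colour-sym = λ {u} {v} e → toℕ-injective
          (trans (col≡ e) (trans (symm u v e) (sym (col≡ (~-sym e)))))
      ; proper     = λ {u} {v} {w} e f v≢w eq → prop u v w e f v≢w
          (trans (sym (col≡ e)) (trans (cong toℕ eq) (col≡ f)))
      ; rainbow-C₄ = λ {w} {x} {y} {z} C → let open FourCycle C in
          Unique.map⁻ {f = toℕ} (subst Unique
            (sym (cong₂ _∷_ (col≡ wx) (cong₂ _∷_ (col≡ xy)
              (cong₂ _∷_ (col≡ yz) (cong₂ _∷_ (col≡ zw) refl)))))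
            (rainbow w x y z C))
      }
      where
      open Valid V
      col : ∀ u v → .(u ~ v) → Fin k
      col u v e = fromℕ< (bounded u v (recompute (u ~? v) e))
      col≡ : ∀ {u v} (e : u ~ v) → toℕ (col u v e) ≡ t u v
      col≡ {u} {v} e = toℕ-fromℕ< (bounded u v e)

    toTable : (c : BColouring G k) (t : Table) →
              (∀ u v (e : u ~ v) → t u v ≡ toℕ (BColouring.colour c u v e)) → Valid k t
    toTable {k} c t t≡ = valid
      (λ u v e → subst (_< k) (sym (t≡ u v e)) (toℕ<n _))
      (λ u v e → trans (t≡ u v e) (trans (cong toℕ (colour-sym e)) (sym (t≡ v u (~-sym e)))))
      (λ u v w e f v≢w eq → proper e f v≢w
        (toℕ-injective (trans (sym (t≡ u v e)) (trans eq (t≡ u w f)))))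
      (λ w x y z C → let open FourCycle C in
        subst Unique
          (sym (cong₂ _∷_ (t≡ w x wx) (cong₂ _∷_ (t≡ x y xy)
            (cong₂ _∷_ (t≡ y z yz) (cong₂ _∷_ (t≡ z w zw) refl)))))
          (Unique.map⁺ {f = toℕ} toℕ-injective (rainbow-C₄ C)))
      where open BColouring c

    decode : Fin (suc k ^ (n * n)) → Table
    decode {k} i u v = toℕ (finToFun {suc k} {n * n} i (combine u v))

    bColouring? : U.Decidable (BColouring G)
    bColouring? k = map′ (λ (i , V) → fromTable V) encode (any? λ i → valid? k (decode {k} i))
      where
      encode : BColouring G k → ∃[ i ] Valid k (decode {k} i)
      encode c = funToFin entries , toTable c _ agree
        where
        open BColouring c
        entry : Fin n → Fin n → Fin (suc k)
        entry u v with u ~? v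
        ... | yes e = inject₁ (colour u v e)
        ... | no  _ = zero
        entry≡ : ∀ u v (e : u ~ v) → toℕ (entry u v) ≡ toℕ (colour u v e)
        entry≡ u v e with u ~? v
        ... | yes e′ = toℕ-inject₁ (colour u v e′)
        ... | no ¬e  = ⊥-elim (¬e e)
        entries : Fin (n * n) → Fin (suc k)
        entries p = uncurry entry (remQuot {n} n p)
        agree : ∀ u v (e : u ~ v) → decode {k} (funToFin entries) u v ≡ toℕ (colour u v e)
        agree u v e = trans (cong toℕ (finToFun-funToFin entries (combine u v)))
          (trans (cong (λ p → toℕ (uncurry entry p)) (remQuot-combine u v))
                 (entry≡ u v e))

    -- Giving all edges distinct colours is a B-colouring.
    code : Fin n → Fin n → Fin (n * n)
    code u v with u ≤ᶠ? v
    ... | yes _ = combine u v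
    ... | no  _ = combine v u

    code-sym : ∀ u v → code u v ≡ code v u
    code-sym u v with u ≤ᶠ? v | v ≤ᶠ? u
    ... | yes p | yes q rewrite ≤ᶠ-antisym p q = refl
    ... | yes _ | no  _ = refl
    ... | no  _ | yes _ = refl
    ... | no ¬p | no ¬q with ≤ᶠ-total u v
    ...   | inj₁ p = ⊥-elim (¬p p)
    ...   | inj₂ q = ⊥-elim (¬q q)

    code-injective : ∀ u v a b → code u v ≡ code a b → (u ≡ a × v ≡ b) ⊎ (u ≡ b × v ≡ a)
    code-injective u v a b eq with u ≤ᶠ? v | a ≤ᶠ? b
    ... | yes _ | yes _ = inj₁ (combine-injective u v a b eq)
    ... | yes _ | no  _ = inj₂ (combine-injective u v b a eq)
    ... | no  _ | yes _ = let p , q = combine-injective v u a b eq in inj₂ (q , p)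
    ... | no  _ | no  _ = let p , q = combine-injective v u b a eq in inj₁ (q , p)

    code-≢ : ∀ {u v a b} → u ≢ a → u ≢ b → code u v ≢ code a b
    code-≢ {u} {v} {a} {b} u≢a u≢b eq with code-injective u v a b eq
    ... | inj₁ (p , _) = u≢a p
    ... | inj₂ (p , _) = u≢b p

    injectiveColouring : BColouring G (n * n)
    injectiveColouring = record
      { colour     = λ u v _ → code u v
      ; colour-sym = λ {u} {v} _ → code-sym u v
      ; proper     = proper
      ; rainbow-C₄ = rainbow
      }
      where
      proper : ∀ {u v w} → u ~ v → u ~ w → v ≢ w → code u v ≢ code u w
      proper {u} {v} {w} e f v≢w eq with code-injective u v u w eq
      ... | inj₁ (_ , v≡w)   = v≢w v≡w
      ... | inj₂ (u≡w , v≡u) = v≢w (trans v≡u u≡w)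
      rainbow : ∀ {w x y z} → FourCycle w x y z →
                Unique (code w x ∷ code x y ∷ code y z ∷ code z w ∷ [])
      rainbow {w} {x} record { distinct = (w≢x ∷ w≢y ∷ w≢z ∷ []) ∷ (x≢y ∷ x≢z ∷ []) ∷ (y≢z ∷ []) ∷ [] ∷ [] } =
        (code-≢ w≢x w≢y ∷ code-≢ w≢y w≢z ∷ (λ eq → code-≢ x≢z (λ p → w≢x (sym p)) (trans (code-sym x w) eq)) ∷ [])
        ∷ (code-≢ x≢y x≢z ∷ code-≢ x≢z (λ p → w≢x (sym p)) ∷ [])
        ∷ (code-≢ y≢z (λ p → w≢y (sym p)) ∷ [])
        ∷ [] ∷ []

-- `abstract` only stops the search from being unfolded: the value is
-- determined by the type.
abstract
  qB-exists : (G : Graph n) → Σ[ q ∈ ℕ ] IsLeast (BColouring G) q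
  qB-exists G = least (Existence.bColouring? G) (Existence.injectiveColouring G)

qB : Graph n → ℕ
qB G = proj₁ (qB-exists G)

qB-isLeast : (G : Graph n) → IsLeast (BColouring G) (qB G)
qB-isLeast G = proj₂ (qB-exists G)

{-# OPTIONS --safe #-}
-- Colour the graph one vertex at a time.  Let K be the subgraph induced on the
-- vertices reached so far together with a new vertex v, which by degeneracy
-- can be chosen with deg_K(v) ≤ d.  The edges at v are coloured one by one;
-- when v u is coloured, a forbidden colour is that of u w with w ∈ N_G(u) ∖ {v}
-- (at most Δ − 1 of these) or that of x w with x ∈ N_K(v) ∖ {u} and
-- w ∈ N_G(u) ∩ N_G(x) (at most (d − 1) Δ₂ of these).  The case w = v of the
-- second kind accounts for the edges v x; the others, for the opposite edges in
-- the 4-cycles u v x w.  So some colour is always available.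
module Submission where

open import Defs
open import Data.Bool.Base using (if_then_else_)
open import Data.Empty using (⊥-elim)
open import Data.Fin.Base using (Fin; zero; suc)
open import Data.Fin.Properties using (¬∀⟶∃¬; pigeonhole; <⇒≢) renaming (_≟_ to _≟ᶠ_)
open import Data.Fin.Subset using (Subset; _∈_; _∉_; _∩_; _-_; ∣_∣; _⊂_; ⊤; inside; outside)
open import Data.Fin.Subset.Induction using (⊂-wellFounded)
open import Data.Fin.Subset.Properties using (_∈?_; ∈⊤; nonempty?; ∣p∩q∣≤∣p∣; x∈p∩q⁺; x∈p∧x≢y⇒x∈p-y; x∈p⇒∣p-x∣<∣p∣; x∈p⇒p-x⊂p)
open import Data.List.Base using (List; []; _∷_; _++_; map; concatMap; length; lookup; filter; allFin; cartesianProduct)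
open import Data.List.Extrema.Nat using (xs≤max; max≤v⁺)
open import Data.List.Membership.Propositional using (lose) renaming (_∈_ to _∈ˡ_; _∉_ to _∉ˡ_)
open import Data.List.Membership.Propositional.Properties using (∈-map⁺; ∈-map⁻; ∈-allFin; ∈-filter⁺; ∈-cartesianProduct⁺; ∈-concatMap⁺; ∈-++⁺ˡ; ∈-++⁺ʳ)
import Data.List.Membership.DecPropositional as DecMembership
open import Data.List.Properties using (length-++; length-map)
open import Data.List.Relation.Unary.All as All using (All; []; _∷_)
import Data.List.Relation.Unary.All.Properties as All
open import Data.List.Relation.Unary.AllPairs using ([]; _∷_)
open import Data.List.Relation.Unary.Unique.Propositional using (Unique)
open import Data.List.Relation.Unary.Any as Any using (here; there)
open import Data.List.Relation.Unary.Any.Properties using (lookup-index)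
open import Data.Nat.Base using (ℕ; zero; suc; _+_; _*_; _∸_; _≤_; _<_; z≤n; s≤s; s≤s⁻¹)
open import Data.Nat.Properties using (≤-trans; ≤-reflexive; +-mono-≤; +-monoʳ-≤; *-monoˡ-≤; *-monoʳ-≤; module ≤-Reasoning)
open import Data.Product.Base using (∃-syntax; _×_; _,_; proj₁; proj₂; uncurry)
open import Data.Sum.Base using (_⊎_; inj₁; inj₂; [_,_])
open import Data.Vec.Base using ([]; _∷_; here; there)
open import Data.Vec.Properties using (lookup∘tabulate; lookup⇒[]=)
open import Function.Base using (_∘_; id)
open import Induction.WellFounded using (Acc; acc)
open import Level using (0ℓ)
open import Relation.Binary.Core using (Rel)
open import Relation.Binary.PropositionalEquality using (_≡_; _≢_; refl; sym; trans; cong; subst; ≢-sym)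
open import Relation.Nullary using (¬_; ¬?; Dec; yes; no; does)
open import Relation.Nullary.Decidable using (_×-dec_; _⊎-dec_; dec-true)

private
  variable
    n k : ℕ

-- Listing subsets, and finding a colour outside a short list.

elements : Subset n → List (Fin n)
elements []            = []
elements (inside  ∷ p) = zero ∷ map suc (elements p)
elements (outside ∷ p) = map suc (elements p)

length-elements : (p : Subset n) → length (elements p) ≡ ∣ p ∣
length-elements []            = refl
length-elements (inside  ∷ p) = cong suc (trans (length-map suc (elements p)) (length-elements p))
length-elements (outside ∷ p) = trans (length-map suc (elements p)) (length-elements p)

∈-elements⁺ : {x : Fin n} {p : Subset n} → x ∈ p → x ∈ˡ elements p
∈-elements⁺ here = here refl
∈-elements⁺ {p = inside  ∷ _} (there x∈p) = there (∈-map⁺ suc (∈-elements⁺ x∈p))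
∈-elements⁺ {p = outside ∷ _} (there x∈p) = ∈-map⁺ suc (∈-elements⁺ x∈p)

∈-elements⁻ : {x : Fin n} (p : Subset n) → x ∈ˡ elements p → x ∈ p
∈-elements⁻ (inside  ∷ p) (here refl) = here
∈-elements⁻ (inside  ∷ p) (there x∈) with ∈-map⁻ suc x∈
... | _ , y∈ , refl = there (∈-elements⁻ p y∈)
∈-elements⁻ (outside ∷ p) x∈ with ∈-map⁻ suc x∈
... | _ , y∈ , refl = there (∈-elements⁻ p y∈)

x∉p-x : (p : Subset n) (x : Fin n) → x ∉ p - x
x∉p-x (inside  ∷ p) zero ()
x∉p-x (outside ∷ p) zero ()
x∉p-x (inside  ∷ p) (suc x) (there x∈) = x∉p-x p x x∈
x∉p-x (outside ∷ p) (suc x) (there x∈) = x∉p-x p x x∈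

length-concatMap-≤ : ∀ {A B : Set} (f : A → List B) {b} (xs : List A) →
                     (∀ {x} → x ∈ˡ xs → length (f x) ≤ b) →
                     length (concatMap f xs) ≤ length xs * b
length-concatMap-≤ f []       _     = z≤n
length-concatMap-≤ f (x ∷ xs) bound = ≤-trans (≤-reflexive (length-++ (f x)))
  (+-mono-≤ (bound (here refl)) (length-concatMap-≤ f xs (bound ∘ there)))

-- If every colour occurred in `xs`, sending each to a position where it occurs would map `Fin k` to
-- fewer than `k` positions; two colours sharing a position would be equal.
fresh : (xs : List (Fin k)) → length xs < k → ∃[ c ] c ∉ˡ xs
fresh {k} xs short = ¬∀⟶∃¬ k (_∈ˡ xs) (_∈?ˡ xs) λ total →
  let i , j , i<j , eq = pigeonhole short (Any.index ∘ total) in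
  <⇒≢ i<j (trans (lookup-index (total i))
            (trans (cong (lookup xs) eq) (sym (lookup-index (total j)))))
  where open DecMembership _≟ᶠ_ using () renaming (_∈?_ to _∈?ˡ_)

-- Degrees, codegrees and induced subgraphs.

module _ (G : Graph n) where
  open Graph G

  ∈-neighbourhood⁺ : ∀ {x y} → x ~ y → y ∈ neighbourhood x
  ∈-neighbourhood⁺ {x} {y} e = lookup⇒[]= y (neighbourhood x)
    (trans (lookup∘tabulate (λ z → does (x ~? z)) y) (dec-true (x ~? y) e))

  degree≤maxDegree : ∀ x → degree x ≤ maxDegree
  degree≤maxDegree x = All.lookup (xs≤max 0 (map degree (allFin n))) (∈-map⁺ degree (∈-allFin x))

  -- Repeats the list local to `maxCodegree`, which is out of scope here; the two agree by
  -- unfolding.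
  distinctPairs : List (Fin n × Fin n)
  distinctPairs = filter (λ (x , y) → ¬? (x ≟ᶠ y)) (cartesianProduct (allFin n) (allFin n))

  codegree≤maxCodegree : ∀ {x y} → x ≢ y → codegree x y ≤ maxCodegree
  codegree≤maxCodegree {x} {y} x≢y = All.lookup (xs≤max 0 (map (uncurry codegree) distinctPairs))
    (∈-map⁺ (uncurry codegree) (∈-filter⁺ (λ (x , y) → ¬? (x ≟ᶠ y))
      (∈-cartesianProduct⁺ (∈-allFin x) (∈-allFin y)) x≢y))

  -- Common neighbours of `x` and `y` are neighbours of `x`. This yields the second inequality of
  -- the theorem.
  maxCodegree≤maxDegree : maxCodegree ≤ maxDegree
  maxCodegree≤maxDegree = max≤v⁺ {xs = map (uncurry codegree) distinctPairs} z≤n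
    (All.map⁺ (All.universal (λ (x , y) →
      ≤-trans (∣p∩q∣≤∣p∣ (neighbourhood x) (neighbourhood y)) (degree≤maxDegree x)) distinctPairs))

  induced : Subset n → Graph n
  induced S = record
    { _~_      = λ x y → x ∈ S × y ∈ S × x ~ y
    ; _~?_     = λ x y → (x ∈? S) ×-dec (y ∈? S) ×-dec (x ~? y)
    ; ~-sym    = λ (x∈ , y∈ , e) → y∈ , x∈ , ~-sym e
    ; ~-irrefl = λ eq (_ , _ , e) → ~-irrefl eq e
    }

  inducedSubgraph : Subset n → Subgraph G
  inducedSubgraph S = record
    { vertices   = S
    ; edges      = induced S
    ; edges⊆G    = λ (_ , _ , e) → e
    ; endpoints∈ = λ (x∈ , y∈ , _) → x∈ , y∈
    }

-- Partial colourings.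

-- The edges satisfying H are coloured, but the rainbow condition refers to all
-- 4-cycles of K: the other two edges of the cycle may still be uncoloured.
record PartialColouring (K : Graph n) (H : Rel (Fin n) 0ℓ) (k : ℕ) : Set where
  open Graph K
  field
    table    : Fin n → Fin n → Fin k
    symm     : ∀ a b → table a b ≡ table b a
    proper   : ∀ {a b c} → H a b → H a c → b ≢ c → table a b ≢ table a c
    opposite : ∀ {w x y z} → H w x → x ~ y → H y z → z ~ w → w ≢ y → x ≢ z →
               table w x ≢ table y z

restrict : ∀ {K : Graph n} {H H′ : Rel (Fin n) 0ℓ} → (∀ {a b} → H′ a b → H a b) →
           PartialColouring K H k → PartialColouring K H′ k
restrict ⊆ P = record
  { table    = table
  ; symm     = symm
  ; proper   = λ h h′ → proper (⊆ h) (⊆ h′)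
  ; opposite = λ h xy h′ → opposite (⊆ h) xy (⊆ h′)
  }
  where open PartialColouring P

Joins : Fin n → Fin n → Rel (Fin n) 0ℓ
Joins u v a b = (a ≡ u × b ≡ v) ⊎ (a ≡ v × b ≡ u)

-- Unfolded, `joins? u v a b` would not match the `with` abstractions over it.
abstract
  joins? : ∀ (u v a b : Fin n) → Dec (Joins u v a b)
  joins? u v a b = ((a ≟ᶠ u) ×-dec (b ≟ᶠ v)) ⊎-dec ((a ≟ᶠ v) ×-dec (b ≟ᶠ u))

Joins-unique : ∀ {u v a b c : Fin n} → u ≢ v → Joins u v a b → Joins u v a c → b ≡ c
Joins-unique u≢v (inj₁ (p , q)) (inj₁ (p′ , q′)) = trans q (sym q′)
Joins-unique u≢v (inj₁ (p , q)) (inj₂ (p′ , q′)) = ⊥-elim (u≢v (trans (sym p) p′))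
Joins-unique u≢v (inj₂ (p , q)) (inj₁ (p′ , q′)) = ⊥-elim (u≢v (trans (sym p′) p))
Joins-unique u≢v (inj₂ (p , q)) (inj₂ (p′ , q′)) = trans q (sym q′)

Joins-swap : ∀ {u v a b : Fin n} → Joins u v a b → Joins u v b a
Joins-swap (inj₁ (p , q)) = inj₂ (q , p)
Joins-swap (inj₂ (p , q)) = inj₁ (q , p)

-- Giving the edge `u v` a colour that avoids the forbidden ones.

module _ {n k : ℕ}
  (K : Graph n) {H H′ : Rel (Fin n) 0ℓ} {u v : Fin n}
  (H-sym : ∀ {a b} → H a b → H b a) (H⊆K : ∀ {a b} → H a b → Graph._~_ K a b)
  (u~v : Graph._~_ K u v) (H′⊆ : ∀ {a b} → H′ a b → Joins u v a b ⊎ H a b)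
  (P : PartialColouring K H k) (c : Fin k)
  (c≢incident : ∀ {w} → H u w → w ≢ v → c ≢ PartialColouring.table P u w)
  (c≢across : ∀ {x w} → Graph._~_ K v x → x ≢ u → H x w → Graph._~_ K w u →
              c ≢ PartialColouring.table P x w)
  where
  open Graph K
  open PartialColouring P

  private
    table′ : Fin n → Fin n → Fin k
    table′ a b = if does (joins? u v a b) then c else table a b

    symm′ : ∀ a b → table′ a b ≡ table′ b a
    symm′ a b with joins? u v a b | joins? u v b a
    ... | yes _ | yes _ = refl
    ... | no  _ | no  _ = symm a b
    ... | yes j | no ¬j = ⊥-elim (¬j (Joins-swap j))
    ... | no ¬j | yes j = ⊥-elim (¬j (Joins-swap j))

    u≢v : u ≢ v
    u≢v u≡v = ~-irrefl u≡v u~v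

    old : ∀ {a b} → H′ a b → ¬ Joins u v a b → H a b
    old h ¬j = [ (λ j → ⊥-elim (¬j j)) , id ] (H′⊆ h)

    c≢at : ∀ {a b w} → Joins u v a b → H a w → b ≢ w → c ≢ table a w
    c≢at (inj₁ (refl , refl)) h b≢w = c≢incident h (≢-sym b≢w)
    -- At the endpoint `v`, the edge `v w` is excluded by the case of `c≢across` in which the common
    -- neighbour is `v` itself.
    c≢at {w = w} (inj₂ (refl , refl)) h b≢w eq =
      c≢across (H⊆K h) (≢-sym b≢w) (H-sym h) (~-sym u~v) (trans eq (symm v w))

    c≢opposite : ∀ {w x y z} → Joins u v w x → x ~ y → H y z → z ~ w → w ≢ y → x ≢ z →
                 c ≢ table y z
    c≢opposite (inj₁ (refl , refl)) xy h zw w≢y x≢z = c≢across xy (≢-sym w≢y) h zw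
    -- The cycle is read backwards, so that it again leaves `v` along an edge other than `v u`.
    c≢opposite {y = y} {z} (inj₂ (refl , refl)) xy h zw w≢y x≢z eq =
      c≢across (~-sym zw) (≢-sym x≢z) (H-sym h) (~-sym xy) (trans eq (symm y z))

    proper′ : ∀ {a b d} → H′ a b → H′ a d → b ≢ d → table′ a b ≢ table′ a d
    proper′ {a} {b} {d} h h′ b≢d with joins? u v a b | joins? u v a d
    ... | yes j | yes j′ = λ _ → b≢d (Joins-unique u≢v j j′)
    ... | yes j | no ¬j′ = c≢at j (old h′ ¬j′) b≢d
    ... | no ¬j | yes j′ = ≢-sym (c≢at j′ (old h ¬j) (≢-sym b≢d))
    ... | no ¬j | no ¬j′ = proper (old h ¬j) (old h′ ¬j′) b≢d

    -- Otherwise `y` would be `w` or `x`; the first is excluded by `w ≢ y`, the second by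
    -- irreflexivity. Hence `c` is never compared with itself on opposite edges.
    Joins-disjoint : ∀ {w x y z} → Joins u v w x → x ~ y → w ≢ y → ¬ Joins u v y z
    Joins-disjoint (inj₁ (refl , refl)) xy w≢y (inj₁ (refl , refl)) = w≢y refl
    Joins-disjoint (inj₁ (refl , refl)) xy w≢y (inj₂ (refl , refl)) = ~-irrefl refl xy
    Joins-disjoint (inj₂ (refl , refl)) xy w≢y (inj₁ (refl , refl)) = ~-irrefl refl xy
    Joins-disjoint (inj₂ (refl , refl)) xy w≢y (inj₂ (refl , refl)) = w≢y refl

    opposite′ : ∀ {w x y z} → H′ w x → x ~ y → H′ y z → z ~ w → w ≢ y → x ≢ z →
                table′ w x ≢ table′ y z
    opposite′ {w} {x} {y} {z} h xy h′ zw w≢y x≢z with joins? u v w x | joins? u v y z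
    ... | yes j | yes j′ = λ _ → Joins-disjoint j xy w≢y j′
    ... | yes j | no ¬j′ = c≢opposite j xy (old h′ ¬j′) zw w≢y x≢z
    ... | no ¬j | yes j′ = ≢-sym (c≢opposite j′ zw (old h ¬j) xy (≢-sym w≢y) (≢-sym x≢z))
    ... | no ¬j | no ¬j′ = opposite (old h ¬j) xy (old h′ ¬j′) zw w≢y x≢z

  recolour : PartialColouring K H′ k
  recolour = record { table = table′ ; symm = symm′ ; proper = proper′ ; opposite = opposite′ }

-- The greedy choice of colours.

-- Here d and Δ are one less than in the theorem.
module Greedy {n : ℕ} (G : Graph n) {d Δ : ℕ} (maxDegree≤ : Graph.maxDegree G ≤ suc Δ) where
  open Graph G

  -- One more than the greatest possible number of forbidden colours. With the shifted parameters,
  -- the bound of the theorem unfolds to this.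
  colours : ℕ
  colours = suc (Δ + d * maxCodegree)

  module _ (K : Graph n) (K⊆G : ∀ {a b} → Graph._~_ K a b → a ~ b) where
    private
      module K = Graph K

    -- Only the neighbours of `v` are counted in `K`, where `v` has small degree. Neighbours of `u`
    -- and common neighbours are counted in `G`, where the maximum degree and codegree bound them.
    -- Table entries at uncoloured edges may be forbidden too; the count already includes them.
    extend : {H H′ : Rel (Fin n) 0ℓ} {u v : Fin n} → K.degree v ≤ suc d →
             (∀ {a b} → H a b → H b a) → (∀ {a b} → H a b → a K.~ b) →
             u K.~ v → (∀ {a b} → H′ a b → Joins u v a b ⊎ H a b) →
             PartialColouring K H colours → PartialColouring K H′ colours
    extend {H} {H′} {u} {v} deg≤ H-sym H⊆K u~v H′⊆ P =
      recolour K H-sym H⊆K u~v H′⊆ P c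
        (λ h w≢v eq → c∉ (∈-++⁺ˡ (subst (_∈ˡ incident) (sym eq)
          (∈-map⁺ (table u) (∈-elements⁺
            (x∈p∧x≢y⇒x∈p-y (∈-neighbourhood⁺ G (K⊆G (H⊆K h))) w≢v))))))
        (λ {x} vx x≢u h wu eq → c∉ (∈-++⁺ʳ incident (∈-concatMap⁺ acrossFrom
          (lose (∈-elements⁺ (x∈p∧x≢y⇒x∈p-y (∈-neighbourhood⁺ K vx) x≢u))
            (subst (_∈ˡ acrossFrom x) (sym eq)
              (∈-map⁺ (table x) (∈-elements⁺ (x∈p∩q⁺
                ( ∈-neighbourhood⁺ G (K⊆G (K.~-sym wu))
                , ∈-neighbourhood⁺ G (K⊆G (H⊆K h)))))))))))
      where
      open PartialColouring P
      open ≤-Reasoning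

      others : Subset n
      others = K.neighbourhood v - u

      incident : List (Fin colours)
      incident = map (table u) (elements (neighbourhood u - v))

      acrossFrom : Fin n → List (Fin colours)
      acrossFrom x = map (table x) (elements (neighbourhood u ∩ neighbourhood x))

      across : List (Fin colours)
      across = concatMap acrossFrom (elements others)

      length-map-elements : (f : Fin n → Fin colours) (p : Subset n) →
                            length (map f (elements p)) ≡ ∣ p ∣
      length-map-elements f p = trans (length-map f (elements p)) (length-elements p)

      incident≤ : length incident ≤ Δ
      incident≤ = s≤s⁻¹ (begin-strict
        length incident         ≡⟨ length-map-elements (table u) (neighbourhood u - v) ⟩
        ∣ neighbourhood u - v ∣ <⟨ x∈p⇒∣p-x∣<∣p∣ (∈-neighbourhood⁺ G (K⊆G u~v)) ⟩
        degree u                ≤⟨ degree≤maxDegree G u ⟩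
        maxDegree               ≤⟨ maxDegree≤ ⟩
        suc Δ                   ∎)

      others≤ : ∣ others ∣ ≤ d
      others≤ = s≤s⁻¹ (≤-trans (x∈p⇒∣p-x∣<∣p∣ (∈-neighbourhood⁺ K (K.~-sym u~v))) deg≤)

      acrossFrom≤ : ∀ {x} → x ∈ˡ elements others → length (acrossFrom x) ≤ maxCodegree
      acrossFrom≤ {x} x∈ = begin
        length (acrossFrom x) ≡⟨ length-map-elements (table x) (neighbourhood u ∩ neighbourhood x) ⟩
        codegree u x          ≤⟨ codegree≤maxCodegree G (λ { refl → x∉p-x (K.neighbourhood v) u (∈-elements⁻ others x∈) }) ⟩
        maxCodegree           ∎

      across≤ : length across ≤ d * maxCodegree
      across≤ = begin
        length across                          ≤⟨ length-concatMap-≤ acrossFrom (elements others) acrossFrom≤ ⟩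
        length (elements others) * maxCodegree ≡⟨ cong (_* maxCodegree) (length-elements others) ⟩
        ∣ others ∣ * maxCodegree               ≤⟨ *-monoˡ-≤ maxCodegree others≤ ⟩
        d * maxCodegree                        ∎

      available : ∃[ c ] c ∉ˡ incident ++ across
      available = fresh (incident ++ across) (s≤s (begin
        length (incident ++ across)     ≡⟨ length-++ incident ⟩
        length incident + length across ≤⟨ +-mono-≤ incident≤ across≤ ⟩
        Δ + d * maxCodegree             ∎))

      c = proj₁ available
      c∉ = proj₂ available

    -- us lists the vertices u whose edge to v has been coloured.
    record Reached (v : Fin n) (us : List (Fin n)) (a b : Fin n) : Set where
      constructor reached
      field
        edge  : a K.~ b
        left  : a ≡ v → b ∈ˡ us
        right : b ≡ v → a ∈ˡ us

    Reached-sym : ∀ {v us a b} → Reached v us a b → Reached v us b a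
    Reached-sym (reached e l r) = reached (K.~-sym e) r l

    Reached-∷ : ∀ {v u us a b} → Reached v (u ∷ us) a b → Joins u v a b ⊎ Reached v us a b
    Reached-∷ {v} {u} {us} {a} {b} (reached e l r) with joins? u v a b
    ... | yes j = inj₁ j
    ... | no ¬j = inj₂ (reached e
      (λ a≡v → Any.tail (λ b≡u → ¬j (inj₂ (a≡v , b≡u))) (l a≡v))
      (λ b≡v → Any.tail (λ a≡u → ¬j (inj₁ (a≡u , b≡v))) (r b≡v)))

    -- Initially exactly the edges of `K` avoiding `v` are coloured. Each listed neighbour of `v`
    -- contributes one use of `extend`; a vertex not adjacent to `v` adds no edge.
    star : ∀ {v} → K.degree v ≤ suc d → PartialColouring K (Reached v []) colours →
           ∀ us → PartialColouring K (Reached v us) colours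
    star deg≤ P [] = P
    star {v} deg≤ P (u ∷ us) with u K.~? v
    ... | yes u~v = extend deg≤ Reached-sym Reached.edge u~v Reached-∷ (star deg≤ P us)
    ... | no  u≁v = restrict ⊆ (star deg≤ P us)
      where
      ⊆ : ∀ {a b} → Reached v (u ∷ us) a b → Reached v us a b
      ⊆ h with Reached-∷ h
      ... | inj₁ (inj₁ (refl , refl)) = ⊥-elim (u≁v (Reached.edge h))
      ... | inj₁ (inj₂ (refl , refl)) = ⊥-elim (u≁v (K.~-sym (Reached.edge h)))
      ... | inj₂ h′ = h′

  -- Induction on the vertex set, and the resulting B-colouring.

  module _ (deg : Degenerate (suc d) G) where

    Full : Subset n → Set
    Full S = PartialColouring (induced G S) (Graph._~_ (induced G S)) colours

    colourInduced : ∀ S → Acc _⊂_ S → Full S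
    colourInduced S (acc rec) with nonempty? S
    ... | no empty = record
      -- There is no edge, so any colour serves; `zero` exists because `colours` is a successor.
      { table    = λ _ _ → zero
      ; symm     = λ _ _ → refl
      ; proper   = λ (a∈ , _) → ⊥-elim (empty (_ , a∈))
      ; opposite = λ (w∈ , _) → ⊥-elim (empty (_ , w∈))
      }
    ... | yes nonempty = restrict up (star K (λ (_ , _ , e) → e) deg≤ start (allFin n))
      where
      K = induced G S
      open Graph K using () renaming (_~_ to _~ᴷ_)
      low : ∃[ v ] v ∈ S × Graph.degree K v ≤ suc d
      low = deg (inducedSubgraph G S) nonempty
      v = proj₁ low
      v∈S = proj₁ (proj₂ low)
      deg≤ = proj₂ (proj₂ low)
      R = Reached K (λ (_ , _ , e) → e) v

      start : PartialColouring K (R []) colours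
      start = record
        { table    = table
        ; symm     = symm
        ; proper   = λ h h′ → proper (down h) (down h′)
        -- `K` has 4-cycles through `v` that are absent from the graph induced on `S - v`. But the
        -- coloured edges `w x` and `y z` avoid `v` and cover the whole cycle, so all four edges lie
        -- in the smaller graph.
        ; opposite = λ h xy h′ zw → opposite (down h) (between h xy h′) (down h′) (between h′ zw h)
        }
        where
        open PartialColouring (colourInduced (S - v) (rec (x∈p⇒p-x⊂p v∈S)))
        ¬∈[] : ∀ {a} {A : Set a} {x : A} → x ∉ˡ []
        ¬∈[] ()
        down : ∀ {a b} → R [] a b → Graph._~_ (induced G (S - v)) a b
        down (reached (a∈ , b∈ , e) l r) =
          x∈p∧x≢y⇒x∈p-y a∈ (λ eq → ¬∈[] (l eq)) , x∈p∧x≢y⇒x∈p-y b∈ (λ eq → ¬∈[] (r eq)) , e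
        between : ∀ {w x y z} → R [] w x → x ~ᴷ y → R [] y z → Graph._~_ (induced G (S - v)) x y
        between h (_ , _ , e) h′ = proj₁ (proj₂ (down h)) , proj₁ (down h′) , e

      up : ∀ {a b} → a ~ᴷ b → R (allFin n) a b
      up {a} {b} e = reached e (λ _ → ∈-allFin b) (λ _ → ∈-allFin a)

    bColouring : BColouring G colours
    bColouring = record
      { colour     = λ u v _ → table u v
      ; colour-sym = λ {u} {v} _ → symm u v
      ; proper     = λ e f → proper (in⊤ e) (in⊤ f)
      ; rainbow-C₄ = rainbow
      }
      where
      open PartialColouring (colourInduced ⊤ (⊂-wellFounded ⊤))
      in⊤ : ∀ {a b} → a ~ b → Graph._~_ (induced G ⊤) a b
      in⊤ e = ∈⊤ , ∈⊤ , e
      consecutive : ∀ {a b c} → a ~ b → b ~ c → a ≢ c → table a b ≢ table b c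
      consecutive {a} {b} e f a≢c eq =
        proper (in⊤ (~-sym e)) (in⊤ f) a≢c (trans (symm b a) eq)
      -- Of the six pairs of edges of the cycle, the four consecutive ones are separated by `proper`
      -- and the two opposite ones by `opposite`.
      rainbow : ∀ {w x y z} (C : FourCycle w x y z) →
                Unique (table w x ∷ table x y ∷ table y z ∷ table z w ∷ [])
      rainbow record { distinct = (w≢x ∷ w≢y ∷ w≢z ∷ []) ∷ (x≢y ∷ x≢z ∷ []) ∷ (y≢z ∷ []) ∷ [] ∷ []
                     ; wx = wx ; xy = xy ; yz = yz ; zw = zw } =
        (consecutive wx xy w≢y ∷ opposite (in⊤ wx) (in⊤ xy) (in⊤ yz) (in⊤ zw) w≢y x≢z
          ∷ ≢-sym (consecutive zw wx (≢-sym x≢z)) ∷ [])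
        ∷ (consecutive xy yz x≢z ∷ opposite (in⊤ xy) (in⊤ yz) (in⊤ zw) (in⊤ wx) x≢z (≢-sym w≢y) ∷ [])
        ∷ (consecutive yz zw (≢-sym w≢y) ∷ [])
        ∷ [] ∷ []

theorem1p1 : ∀ (d Δ : ℕ) → 1 ≤ d → d ≤ Δ →
    ∀ {n} (G : Graph n) → Degenerate d G → Graph.maxDegree G ≤ Δ →
    (qB G ≤ Δ + (d ∸ 1) * Graph.maxCodegree G) ×
    (Δ + (d ∸ 1) * Graph.maxCodegree G ≤ d * Δ)
theorem1p1 (suc d) (suc Δ) _ _ G deg maxDegree≤ =
  proj₂ (qB-isLeast G) (Greedy.bColouring G maxDegree≤ deg) ,
  -- `suc d * suc Δ` unfolds to `suc Δ + d * suc Δ`, so bounding the maximum codegree by `suc Δ`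
  -- suffices.
  +-monoʳ-≤ (suc Δ) (*-monoʳ-≤ d (≤-trans (maxCodegree≤maxDegree G) maxDegree≤))
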